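{- Let $G$ be a finite graph and $a\in V(G)$. Suppose $G=H_1\cup\dots\cup H_m$ ($m\ge1$), where each $H_j$ is a connected subgraph of $G$ containing $a$ such that $H_j-a$ is nonempty and connected, $V(H_j)\cap V(H_l)=\{a\}$ for $j\ne l$, and every edge of $G$ lies in exactly one $H_j$. Call $H_j$ and $H_l$ equivalent if there is a graph isomorphism $H_j\to H_l$ mapping $a$ to $a$, and suppose there are $g$ equivalence classes, the $i$-th consisting of $m_i$ graphs each isomorphic (with $a\mapsto a$) to a graph $G_i$. Then for every positive integer $k$, $$D(G,k;a)=k\prod_{i=1}^g\binom{D(G_i,k;a)/k}{m_i}.$$
   Context: A $k$-labeling of a graph $X$ is a map $\phi:V(X)\to\{1,\dots,k\}$; an automorphism $\pi$ preserves $\phi$ if $\phi(\pi(v))=\phi(v)$ for all $v$. For a subgroup $\Gamma\le\mathrm{Aut}(X)$, $\phi$ is $\Gamma$-distinguishing if the only element of $\Gamma$ preserving $\phi$ is the identity; $\phi,\phi'$ are equivalent with respect to $\Gamma$ if some $\pi\in\Gamma$ satisfies $\phi'(\pi(v))=\phi(v)$ for all $v$; $D(X,k;\Gamma)$ is the number of $\Gamma$-equivalence classes of $\Gamma$-distinguishing $k$-labelings. For a vertex $a$, $\mathrm{Aut}(X;a)$ is the group of automorphisms of $X$ fixing $a$, and $D(X,k;a):=D(X,k;\mathrm{Aut}(X;a))$ (which is divisible by $k$). -}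

module Defs where

open import Data.Bool using (Bool; true; false; T)
import Data.Bool.Properties as Bool
open import Data.Fin using (Fin; finToFun; funToFin)
open import Data.Fin.Properties using (any?; all?; finToFun-funToFin; _≟_)
open import Data.Irrelevant using ([_])
open import Data.List using (List; length; map; filter; deduplicate; allFin)
open import Data.Nat using (ℕ; _^_)
open import Data.Product using (Σ; ∃; ∃!; _×_; _,_; proj₁; proj₂)
open import Data.Refinement using (Refinement; Refinement-syntax; value; _,_)
open import Function using (_∘_; _⇔_; _↔_; Inverse; mk↔ₛ′; Surjective)
open import Function.Properties.Inverse using (↔-refl; ↔-sym; ↔-trans; ↔⇒↣)
open import Relation.Binary using (DecidableEquality)
open import Relation.Binary.Construct.Closure.ReflexiveTransitive using (Star)
open import Relation.Binary.PropositionalEquality using (_≡_; _≢_; _≗_; refl; sym; trans; cong; cong₂; subst)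
open import Relation.Nullary using (Dec; yes; no; ¬?; _×-dec_)
open import Relation.Nullary.Decidable using (map′; via-injection; decidable-stable)
open import Relation.Unary using (Pred; Decidable)
open import Level using (0ℓ)

record Graph : Set₁ where
  field
    V          : Set
    adj        : V → V → Bool
    adj-sym    : ∀ u v → adj u v ≡ adj v u
    adj-irrefl : ∀ v → adj v v ≡ false

  _~_ : V → V → Set
  u ~ v = T (adj u v)

open Graph public using (V)

Finite : Graph → Set
Finite X = ∃ λ n → V X ↔ Fin n

Connected : Graph → Set
Connected X = ∀ u v → Star (Graph._~_ X) u v

-- X − a.  Membership proofs are irrelevant (Refinement), so each vertex of X
-- other than a occurs exactly once.
_-_ : (X : Graph) → V X → Graph
X - a = record
  { V          = [ v ∈ V X ∣ v ≢ a ]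
  ; adj        = λ u v → adj (value u) (value v)
  ; adj-sym    = λ u v → adj-sym (value u) (value v)
  ; adj-irrefl = λ v → adj-irrefl (value v)
  }
  where open Graph X hiding (V)

record Subgraph (X : Graph) : Set where
  open Graph X using (adj)
  field
    inV     : V X → Bool
    inE     : V X → V X → Bool
    inE-sym : ∀ u v → inE u v ≡ inE v u
    inE⇒adj : ∀ u v → T (inE u v) → T (adj u v)
    inE⇒inV : ∀ u v → T (inE u v) → T (inV u)

module _ {X : Graph} where

  _∈V_ : V X → Subgraph X → Set
  v ∈V H = T (Subgraph.inV H v)

  ⟨_,_⟩∈E_ : V X → V X → Subgraph X → Set
  ⟨ u , v ⟩∈E H = T (Subgraph.inE H u v)

  asGraph : Subgraph X → Graph
  asGraph H = record
    { V          = [ v ∈ V X ∣ v ∈V H ]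
    ; adj        = λ u v → inE (value u) (value v)
    ; adj-sym    = λ u v → inE-sym (value u) (value v)
    ; adj-irrefl = λ v → no-loop (value v)
    }
    where
    open Graph X hiding (V)
    open Subgraph H
    no-loop : ∀ v → inE v v ≡ false
    no-loop v with inE v v | inE⇒adj v v
    ... | false | _ = refl
    ... | true | e rewrite adj-irrefl v with () ← e _

  asVertex : (H : Subgraph X) (v : V X) → v ∈V H → V (asGraph H)
  asVertex H v p = v , [ p ]

record Iso (X Y : Graph) : Set where
  field
    bij      : V X ↔ V Y
    adj-pres : ∀ u v → Graph.adj Y (Inverse.to bij u) (Inverse.to bij v) ≡ Graph.adj X u v

  open Inverse bij public using (to; from; strictlyInverseˡ; strictlyInverseʳ)

idIso : ∀ {X} → Iso X X
idIso = record { bij = ↔-refl ; adj-pres = λ _ _ → refl }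

_⁻¹ : ∀ {X Y} → Iso X Y → Iso Y X
_⁻¹ {X} {Y} f = record
  { bij      = ↔-sym bij
  ; adj-pres = λ u v → trans (sym (adj-pres (from u) (from v)))
                         (cong₂ (Graph.adj Y) (strictlyInverseˡ u) (strictlyInverseˡ v))
  }
  where open Iso f

_⨾_ : ∀ {X Y Z} → Iso X Y → Iso Y Z → Iso X Z
f ⨾ h = record
  { bij      = ↔-trans (Iso.bij f) (Iso.bij h)
  ; adj-pres = λ u v → trans (Iso.adj-pres h _ _) (Iso.adj-pres f u v)
  }

RootedIso : (X : Graph) → V X → (Y : Graph) → V Y → Set
RootedIso X x Y y = Σ (Iso X Y) λ f → Iso.to f x ≡ y

Aut : Graph → Set
Aut X = Iso X X

-- Automorphisms are identified when they agree as maps on vertices, hence resp.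
record Subgroup (X : Graph) : Set₁ where
  field
    Mem  : Pred (Aut X) 0ℓ
    resp : ∀ {π ρ} → Iso.to π ≗ Iso.to ρ → Mem π → Mem ρ
    id∈  : Mem idIso
    ⨾∈   : ∀ {π ρ} → Mem π → Mem ρ → Mem (π ⨾ ρ)
    ⁻¹∈  : ∀ {π} → Mem π → Mem (π ⁻¹)

_∈ᴳ_ : {X : Graph} → Aut X → Subgroup X → Set
π ∈ᴳ Γ = Subgroup.Mem Γ π

Aut[_⨟_] : (X : Graph) → V X → Subgroup X
Aut[ X ⨟ a ] = record
  { Mem  = λ π → Iso.to π a ≡ a
  ; resp = λ e p → trans (sym (e a)) p
  ; id∈  = refl
  ; ⨾∈   = λ {π} {ρ} p q → trans (cong (Iso.to ρ) p) q
  ; ⁻¹∈  = λ {π} p → trans (cong (Iso.from π) (sym p)) (Iso.strictlyInverseʳ π a)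
  }

Labeling : Graph → ℕ → Set
Labeling X k = V X → Fin k

module _ {X : Graph} {k : ℕ} where

  Preserves : Aut X → Labeling X k → Set
  Preserves π φ = ∀ v → φ (Iso.to π v) ≡ φ v

  Distinguishing : Subgroup X → Labeling X k → Set
  Distinguishing Γ φ = ∀ π → π ∈ᴳ Γ → Preserves π φ → ∀ v → Iso.to π v ≡ v

  Equivalent : Subgroup X → Labeling X k → Labeling X k → Set
  Equivalent Γ φ φ′ = ∃ λ π → π ∈ᴳ Γ × (∀ v → φ′ (Iso.to π v) ≡ φ v)

module _ {X : Graph} (fin : Finite X) where
  private
    n = proj₁ fin
    open module Enum = Inverse (proj₂ fin) using () renaming
      (to to index; from to vertex; strictlyInverseʳ to vertex-index)

  _≟V_ : DecidableEquality (V X)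
  _≟V_ = via-injection (↔⇒↣ (proj₂ fin)) _≟_

  allV? : {P : V X → Set} → Decidable P → Dec (∀ v → P v)
  allV? {P} P? = map′ (λ h v → subst P (vertex-index v) (h (index v)))
                      (λ h i → h (vertex i)) (all? (P? ∘ vertex))

  private
    decode : Fin (n ^ n) → V X → V X
    decode i = vertex ∘ finToFun i ∘ index

    encode : (V X → V X) → Fin (n ^ n)
    encode f = funToFin (index ∘ f ∘ vertex)

    decode-encode : ∀ f → decode (encode f) ≗ f
    decode-encode f v = trans (cong vertex (finToFun-funToFin (index ∘ f ∘ vertex) (index v)))
                          (trans (vertex-index _) (cong f (vertex-index v)))

    IsAut : (f g : V X → V X) → Set
    IsAut f g = (∀ v → f (g v) ≡ v) × (∀ v → g (f v) ≡ v)
              × (∀ u v → Graph.adj X (f u) (f v) ≡ Graph.adj X u v)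

    isAut? : ∀ f g → Dec (IsAut f g)
    isAut? f g = allV? (λ v → f (g v) ≟V v) ×-dec allV? (λ v → g (f v) ≟V v)
           ×-dec allV? (λ u → allV? λ v → Graph.adj X (f u) (f v) Bool.≟ Graph.adj X u v)

    mkAut : ∀ f g → IsAut f g → Aut X
    mkAut f g (p , q , r) = record { bij = mk↔ₛ′ f g p q ; adj-pres = r }

    Σ-dec : {A : Set} {B : A → Set} → Dec A → (∀ x → Dec (B x)) → (∀ x y → B x → B y) → Dec (Σ A B)
    Σ-dec (no ¬a) B? _ = no (¬a ∘ proj₁)
    Σ-dec (yes a) B? t = map′ (a ,_) (λ (x , b) → t x a b) (B? a)

  anyAut? : {P : Aut X → Set} → Decidable P →
            (∀ {π ρ} → Iso.to π ≗ Iso.to ρ → P π → P ρ) → Dec (∃ P)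
  anyAut? {P} P? resp = map′
    (λ (i , j , p , h) → mkAut (decode i) (decode j) p , h)
    complete
    (any? λ i → any? λ j → Σ-dec (isAut? (decode i) (decode j))
      (λ p → P? (mkAut _ _ p)) (λ p q → resp {mkAut _ _ p} {mkAut _ _ q} λ _ → refl))
    where
    complete : ∃ P → ∃ λ i → ∃ λ j → Σ (IsAut (decode i) (decode j)) (P ∘ mkAut _ _)
    complete (π , h) = encode to , encode from , p , resp {π} {mkAut _ _ p} (sym ∘ decode-encode to) h
      where
      open Iso π
      p : IsAut (decode (encode to)) (decode (encode from))
      p = (λ v → trans (decode-encode to _) (trans (cong to (decode-encode from v)) (strictlyInverseˡ v)))
        , (λ v → trans (decode-encode from _) (trans (cong from (decode-encode to v)) (strictlyInverseʳ v)))
        , (λ u v → trans (cong₂ (Graph.adj X) (decode-encode to u) (decode-encode to v)) (adj-pres u v))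

  module _ {k : ℕ} (Γ : Subgroup X) (Γ? : Decidable (_∈ᴳ Γ)) where

    equivalent? : (φ φ′ : Labeling X k) → Dec (Equivalent Γ φ φ′)
    equivalent? φ φ′ = anyAut?
      (λ π → Γ? π ×-dec allV? (λ v → φ′ (Iso.to π v) ≟ φ v))
      (λ {π} {ρ} e (m , h) → Subgroup.resp Γ {π} {ρ} e m , λ v → trans (cong φ′ (sym (e v))) (h v))

    distinguishing? : Decidable (Distinguishing {k = k} Γ)
    distinguishing? φ = map′
      (λ none π m h → decidable-stable (allV? λ v → Iso.to π v ≟V v) (λ π≢id → none (π , m , h , π≢id)))
      (λ d (π , m , h , π≢id) → π≢id (d π m h))
      (¬? (anyAut?
        (λ π → Γ? π ×-dec allV? (λ v → φ (Iso.to π v) ≟ φ v) ×-dec ¬? (allV? λ v → Iso.to π v ≟V v))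
        (λ {π} {ρ} e (m , h , ≢id) → Subgroup.resp Γ {π} {ρ} e m
          , (λ v → trans (cong φ (sym (e v))) (h v))
          , (λ ρ≡id → ≢id λ v → trans (e v) (ρ≡id v)))))

  -- Up to pointwise equality, every labeling occurs exactly once:
  -- finToFun decodes Fin (k ^ n) as the functions Fin n → Fin k.
  labelings : ∀ k → List (Labeling X k)
  labelings k = map (λ i → finToFun i ∘ index) (allFin (k ^ n))

-- D(X, k; Γ): one representative is kept for each class.
DΓ : (X : Graph) → Finite X → ℕ → (Γ : Subgroup X) → Decidable (_∈ᴳ Γ) → ℕ
DΓ X fin k Γ Γ? =
  length (deduplicate (equivalent? fin Γ Γ?) (filter (distinguishing? fin Γ Γ?) (labelings {X} fin k)))

-- D(X, k; a) = D(X, k; Aut(X; a))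
D : (X : Graph) → Finite X → ℕ → V X → ℕ
D X fin k a = DΓ X fin k Aut[ X ⨟ a ] (λ π → _≟V_ {X} fin (Iso.to π a) a)

record IsDecomposition (G : Graph) (a : V G) {m : ℕ} (H : Fin m → Subgraph G) : Set where
  open Graph G using (_~_)
  field
    root∈ : ∀ j → a ∈V H j

  root : ∀ j → V (asGraph (H j))
  root j = asVertex (H j) a (root∈ j)

  field
    connected    : ∀ j → Connected (asGraph (H j))
    -a-nonempty  : ∀ j → V (asGraph (H j) - root j)
    -a-connected : ∀ j → Connected (asGraph (H j) - root j)
    V-cover      : ∀ v → ∃ λ j → v ∈V H j
    V-meet       : ∀ {j l} → j ≢ l → ∀ v → v ∈V H j → v ∈V H l → v ≡ a
    E-partition  : ∀ u v → u ~ v → ∃! _≡_ λ j → ⟨ u , v ⟩∈E H j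

-- The rooted-isomorphism classes of the H j are indexed by Fin g; class j is
-- the index of the class of H j, and (Gᵢ i , b i) is a model of the i-th class.
record IsClassification {G : Graph} {a : V G} {m : ℕ} {H : Fin m → Subgraph G}
                        (dec : IsDecomposition G a H) {g : ℕ} (class : Fin m → Fin g)
                        (Gᵢ : Fin g → Graph) (b : ∀ i → V (Gᵢ i)) : Set where
  open IsDecomposition dec
  field
    class-kernel : ∀ j l → class j ≡ class l ⇔ RootedIso (asGraph (H j)) (root j) (asGraph (H l)) (root l)
    class-onto   : Surjective _≡_ _≡_ class
    model        : ∀ j → RootedIso (asGraph (H j)) (root j) (Gᵢ (class j)) (b (class j))

multiplicity : ∀ {m g} → (Fin m → Fin g) → Fin g → ℕ
multiplicity {m} class i = length (filter (λ j → class j ≟ i) (allFin m))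

{-# OPTIONS --safe #-}

-- An automorphism of G fixing a permutes the branches H j, because each H j − a is connected, and
-- conversely rooted isomorphisms between branches glue to automorphisms of G.  Hence a labeling of G
-- is distinguishing iff its restrictions to the branches are distinguishing and pairwise
-- non-isomorphic as rooted labeled graphs, and two such labelings are equivalent iff they induce the
-- same set of isomorphism classes on the branches.  Fixing the label of the root, which accounts for
-- the factor k, an equivalence class on G is therefore a choice, for each i, of mᵢ of the
-- D(Gᵢ,k;a)/k classes on Gᵢ.

module Submission where

open import Defs
open import Data.Bool using (Bool; true; false; T)
open import Data.Bool.Properties using (T?)
open import Data.Fin using (Fin; zero; suc; combine; remQuot; funToFin)
open import Data.Fin.Permutation using (↔⇒≡)
open import Data.Fin.Properties using (_≟_; any?; combine-injective; combine-remQuot; finToFun-funToFin; suc-injective)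
open import Data.Fin.Subset using (Subset; inside; outside; ∣_∣; _∈_; _⊆_)
open import Data.Fin.Subset.Properties using (⊆-antisym)
open import Data.Irrelevant using ([_])
open import Data.List using (List; []; _∷_; _++_; map; length; lookup; filter; deduplicate; tabulate; product; allFin)
open import Data.List.Properties using (length-map; length-++; tabulate-cong)
open import Data.List.Membership.Propositional using () renaming (_∈_ to _∈ᴸ_)
open import Data.List.Membership.Propositional.Properties using (∈-map⁺; ∈-map⁻; ∈-++⁺ˡ; ∈-++⁺ʳ; ∈-allFin; ∈-filter⁺; ∈-lookup)
import Data.List.Membership.Setoid as Membership
import Data.List.Membership.Setoid.Properties as Membershipₚ
open import Data.List.Relation.Unary.All as All using (All; []; _∷_)
import Data.List.Relation.Unary.All.Properties as Allₚ
open import Data.List.Relation.Unary.AllPairs using ([]; _∷_)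
open import Data.List.Relation.Unary.Any as Any using (here; there)
import Data.List.Relation.Unary.Any.Properties as Anyₚ
import Data.List.Relation.Unary.Unique.DecSetoid.Properties as DecUniqueₚ
import Data.List.Relation.Unary.Unique.Propositional.Properties as Uniqueₚ
import Data.List.Relation.Unary.Unique.Setoid as Unique
open import Data.Nat using (ℕ; zero; suc; _+_; _*_; _/_; _≥_; NonZero; z≤n)
open import Data.Nat.Combinatorics using (_C_; nCk≡nC[n∸k]; nCn≡1; nCk+nC[k+1]≡[n+1]C[k+1])
open import Data.Nat.DivMod using (m*n/n≡m)
open import Data.Nat.Properties using (*-comm) renaming (suc-injective to ℕ-suc-injective)
open import Data.Product using (Σ; ∃; _×_; _,_; proj₁; proj₂)
open import Data.Product.Properties using (≡-dec)
open import Data.Product.Properties.WithK using (,-injectiveʳ)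
open import Data.Product.Relation.Binary.Pointwise.NonDependent using (_×ₛ_)
open import Data.Refinement using (value) renaming (_,_ to _,ᵣ_)
open import Data.Vec as Vec using ([]; _∷_; here; there)
open import Data.Vec.Properties using (∷-injectiveʳ; lookup⇒[]=; []=⇒lookup; lookup∘tabulate)
open import Function using (_∘_; Inverse; Equivalence; case_of_; mk↔ₛ′)
import Function.Construct.Composition as Compose
import Function.Construct.Symmetry as Symmetry
open import Function.Properties.Inverse using (↔-refl)
open import Level using (0ℓ)
open import Relation.Binary using (Setoid; DecSetoid; _Respects_)
open import Relation.Binary.Construct.Closure.ReflexiveTransitive using (Star; ε; _◅_)
import Relation.Binary.Construct.On as On
open import Relation.Binary.PropositionalEquality as ≡ using (_≡_; _≢_; _≗_; refl; sym; trans; cong; cong₂; subst)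
open import Relation.Nullary using (does; yes; no; contradiction; recompute; _×-dec_)
open import Relation.Nullary.Decidable using (dec-true)
open import Relation.Nullary.Recomputable using (¬-recompute)
open import Relation.Unary using (Decidable)

-- Cardinalities of setoids

module _ (S T : Setoid 0ℓ 0ℓ) where
  private
    module S = Setoid S
    module T = Setoid T

  -- Congruence of `from` and the left inverse law both come from injectivity of `to` applied to the
  -- right inverse law.
  mkInverse : (to : S.Carrier → T.Carrier) (from : T.Carrier → S.Carrier) →
              (∀ {x y} → x S.≈ y → to x T.≈ to y) → (∀ {x y} → to x T.≈ to y → x S.≈ y) →
              (∀ y → to (from y) T.≈ y) → Inverse S T
  mkInverse to from to-cong to-injective to-from = record
    { to        = to
    ; from      = from
    ; to-cong   = to-cong
    ; from-cong = λ y≈y′ → to-injective (T.trans (to-from _) (T.trans y≈y′ (T.sym (to-from _))))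
    ; inverse   = (λ x≈ → T.trans (to-cong x≈) (to-from _))
                , (λ y≈ → to-injective (T.trans (to-from _) y≈))
    }

inverse-injective : {S T : Setoid 0ℓ 0ℓ} (e : Inverse S T) → ∀ {x y} →
                    Setoid._≈_ T (Inverse.to e x) (Inverse.to e y) → Setoid._≈_ S x y
inverse-injective {S} e eq = S.trans (S.sym (strictlyInverseʳ _)) (inverseʳ eq)
  where
  module S = Setoid S
  open Inverse e

-- Quotients are kept as setoids, so the size is the number of `≈`-classes.
HasSize : Setoid 0ℓ 0ℓ → ℕ → Set
HasSize S n = Inverse S (≡.setoid (Fin n))

size-unique : {S : Setoid 0ℓ 0ℓ} {m n : ℕ} → HasSize S m → HasSize S n → m ≡ n
size-unique e f = ↔⇒≡ (Compose.inverse (Symmetry.inverse e) f)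

-- Equality ignores the proofs of `P`, so an element is counted once whatever proof it carries.
_∣ₛ_ : (S : Setoid 0ℓ 0ℓ) → (Setoid.Carrier S → Set) → Setoid 0ℓ 0ℓ
S ∣ₛ P = On.setoid S (proj₁ {B = P})

module _ (S : Setoid 0ℓ 0ℓ) where
  open Setoid S using (Carrier; _≈_) renaming (sym to ≈-sym; trans to ≈-trans)
  open Membership S using () renaming (_∈_ to _∈ₛ_)

  index-unique : ∀ {x xs} → Unique.Unique S xs → (x∈ : x ∈ₛ xs) (i : Fin (length xs)) →
                 x ≈ lookup xs i → Any.index x∈ ≡ i
  index-unique (_ ∷ u)  (here _)   zero    _  = refl
  index-unique (≉s ∷ _) (here x≈)  (suc i) eq =
    contradiction (≈-trans (≈-sym x≈) eq) (All.lookup ≉s (∈-lookup i))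
  index-unique (≉s ∷ _) (there x∈) zero    eq = contradiction
    (Membershipₚ.∈-resp-≈ S eq x∈) (Membershipₚ.All[≉]⇒∉ S ≉s)
  index-unique (_ ∷ u)  (there x∈) (suc i) eq = cong suc (index-unique u x∈ i eq)

  -- An element is sent to the position of its class in `xs`; by `index-unique` this position does
  -- not depend on the representative.
  enumeration⇒size : {P : Carrier → Set} (xs : List Carrier) → All P xs → Unique.Unique S xs →
                     (∀ {x} → P x → x ∈ₛ xs) → HasSize (S ∣ₛ P) (length xs)
  enumeration⇒size xs allP uniq complete = mkInverse (S ∣ₛ _) (≡.setoid _)
    (λ (_ , p) → Any.index (complete p))
    (λ i → lookup xs i , All.lookup allP (∈-lookup i))
    (λ {_} {(_ , q)} x≈y → index-unique uniq _ _ (≈-trans x≈y (Anyₚ.lookup-index (complete q))))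
    (λ {(_ , p)} {(_ , q)} → Membershipₚ.index-injective S (complete p) (complete q))
    (λ i → index-unique uniq _ i (Setoid.refl S))

×-size : {S T : Setoid 0ℓ 0ℓ} {m n : ℕ} → HasSize S m → HasSize T n → HasSize (S ×ₛ T) (m * n)
×-size {S} {T} {m} {n} e f = mkInverse (S ×ₛ T) (≡.setoid _)
  (λ (x , y) → combine (E.to x) (F.to y))
  (λ i → E.from (proj₁ (remQuot {m} n i)) , F.from (proj₂ (remQuot {m} n i)))
  (λ (x≈ , y≈) → cong₂ combine (E.to-cong x≈) (F.to-cong y≈))
  (λ eq → let x≡ , y≡ = combine-injective _ _ _ _ eq
          in inverse-injective {S} e x≡ , inverse-injective {T} f y≡)
  (λ i → trans (cong₂ combine (E.strictlyInverseˡ _) (F.strictlyInverseˡ _)) (combine-remQuot {m} n i))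
  where
  module E = Inverse e
  module F = Inverse f

Πₛ : {n : ℕ} → (Fin n → Setoid 0ℓ 0ℓ) → Setoid 0ℓ 0ℓ
Πₛ S = record
  { Carrier       = ∀ i → Setoid.Carrier (S i)
  ; _≈_           = λ f h → ∀ i → Setoid._≈_ (S i) (f i) (h i)
  ; isEquivalence = record
    { refl  = λ i → Setoid.refl (S i)
    ; sym   = λ e i → Setoid.sym (S i) (e i)
    ; trans = λ e e′ i → Setoid.trans (S i) (e i) (e′ i)
    }
  }

Π-size : ∀ {n} {S : Fin n → Setoid 0ℓ 0ℓ} {c : Fin n → ℕ} →
         (∀ i → HasSize (S i) (c i)) → HasSize (Πₛ S) (product (tabulate c))
Π-size {zero} {S} _ = mkInverse (Πₛ S) (≡.setoid _) (λ _ → zero) (λ _ ())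
  (λ _ → refl) (λ _ ()) (λ { zero → refl })
Π-size {suc n} {S} e = Compose.inverse split
  (×-size {S zero} {Πₛ (S ∘ suc)} (e zero) (Π-size {S = S ∘ suc} (e ∘ suc)))
  where
  split : Inverse (Πₛ S) (S zero ×ₛ Πₛ (S ∘ suc))
  split = mkInverse (Πₛ S) (S zero ×ₛ Πₛ (S ∘ suc))
    (λ f → f zero , f ∘ suc) (λ (x , f) → λ { zero → x ; (suc i) → f i })
    (λ e → e zero , e ∘ suc) (λ (x , f) → λ { zero → x ; (suc i) → f i })
    (λ _ → Setoid.refl (S zero ×ₛ Πₛ (S ∘ suc)))

-- Subsets of a finite set

-- The clauses follow Pascal's rule, so that the length satisfies the recursion of the binomial
-- coefficients.
choose : (n m : ℕ) → List (Subset n)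
choose zero    zero    = [] ∷ []
choose zero    (suc m) = []
choose (suc n) zero    = map (outside ∷_) (choose n zero)
choose (suc n) (suc m) = map (inside ∷_) (choose n m) ++ map (outside ∷_) (choose n (suc m))

length-choose : ∀ n m → length (choose n m) ≡ n C m
length-choose zero    zero    = refl
length-choose zero    (suc m) = refl
length-choose (suc n) zero    = trans (length-map _ (choose n zero)) (trans (length-choose n zero)
  (trans (nC0≡1 n) (sym (nC0≡1 (suc n)))))
  where
  nC0≡1 : ∀ n → n C 0 ≡ 1
  nC0≡1 n = trans (nCk≡nC[n∸k] {0} {n} z≤n) (nCn≡1 n)
length-choose (suc n) (suc m) = trans (length-++ (map (inside ∷_) (choose n m)))
  (trans (cong₂ _+_ (trans (length-map _ (choose n m)) (length-choose n m))
                    (trans (length-map _ (choose n (suc m))) (length-choose n (suc m))))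
         (nCk+nC[k+1]≡[n+1]C[k+1] n m))

choose-sound : ∀ n m → All (λ s → ∣ s ∣ ≡ m) (choose n m)
choose-sound zero    zero    = refl ∷ []
choose-sound zero    (suc m) = []
choose-sound (suc n) zero    = Allₚ.map⁺ (choose-sound n zero)
choose-sound (suc n) (suc m) = Allₚ.++⁺ (Allₚ.map⁺ (All.map (cong suc) (choose-sound n m)))
                                        (Allₚ.map⁺ (choose-sound n (suc m)))

choose-complete : ∀ {n m} (s : Subset n) → ∣ s ∣ ≡ m → s ∈ᴸ choose n m
choose-complete []                        refl = here refl
choose-complete {m = zero}  (outside ∷ s) eq   = ∈-map⁺ (outside ∷_) (choose-complete s eq)
choose-complete {m = suc m} (outside ∷ s) eq   =
  ∈-++⁺ʳ (map (inside ∷_) (choose _ m)) (∈-map⁺ (outside ∷_) (choose-complete s eq))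
choose-complete {m = suc m} (inside ∷ s)  eq   =
  ∈-++⁺ˡ (∈-map⁺ (inside ∷_) (choose-complete s (ℕ-suc-injective eq)))

choose-unique : ∀ n m → Unique.Unique (≡.setoid _) (choose n m)
choose-unique zero    zero    = [] ∷ []
choose-unique zero    (suc m) = []
choose-unique (suc n) zero    = Uniqueₚ.map⁺ ∷-injectiveʳ (choose-unique n zero)
choose-unique (suc n) (suc m) = Uniqueₚ.++⁺
  (Uniqueₚ.map⁺ ∷-injectiveʳ (choose-unique n m)) (Uniqueₚ.map⁺ ∷-injectiveʳ (choose-unique n (suc m)))
  λ (p , q) → case ∈-map⁻ (inside ∷_) p , ∈-map⁻ (outside ∷_) q of λ { ((_ , _ , refl) , (_ , _ , ())) }

SubsetsOfSize : ℕ → ℕ → Setoid 0ℓ 0ℓ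
SubsetsOfSize n m = ≡.setoid (Subset n) ∣ₛ λ s → ∣ s ∣ ≡ m

subsets-size : ∀ n m → HasSize (SubsetsOfSize n m) (n C m)
subsets-size n m = subst (HasSize (SubsetsOfSize n m)) (length-choose n m)
  (enumeration⇒size _ (choose n m) (choose-sound n m) (choose-unique n m) (choose-complete _))

elements : ∀ {n} → Subset n → List (Fin n)
elements []            = []
elements (inside ∷ s)  = zero ∷ map suc (elements s)
elements (outside ∷ s) = map suc (elements s)

length-elements : ∀ {n} (s : Subset n) → length (elements s) ≡ ∣ s ∣
length-elements []            = refl
length-elements (inside ∷ s)  = cong suc (trans (length-map suc (elements s)) (length-elements s))
length-elements (outside ∷ s) = trans (length-map suc (elements s)) (length-elements s)

elements-sound : ∀ {n} (s : Subset n) → All (_∈ s) (elements s)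
elements-sound []            = []
elements-sound (inside ∷ s)  = here ∷ Allₚ.map⁺ (All.map there (elements-sound s))
elements-sound (outside ∷ s) = Allₚ.map⁺ (All.map there (elements-sound s))

elements-complete : ∀ {n} {x : Fin n} {s} → x ∈ s → x ∈ᴸ elements s
elements-complete {s = inside ∷ s}  here      = here refl
elements-complete {s = inside ∷ s}  (there p) = there (∈-map⁺ suc (elements-complete p))
elements-complete {s = outside ∷ s} (there p) = ∈-map⁺ suc (elements-complete p)

elements-unique : ∀ {n} (s : Subset n) → Unique.Unique (≡.setoid _) (elements s)
elements-unique []            = []
elements-unique (inside ∷ s)  = Allₚ.map⁺ (All.universal (λ _ ()) _) ∷ Uniqueₚ.map⁺ suc-injective (elements-unique s)
elements-unique (outside ∷ s) = Uniqueₚ.map⁺ suc-injective (elements-unique s)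

subset-size : ∀ {n} (s : Subset n) → HasSize (≡.setoid (Fin n) ∣ₛ (_∈ s)) ∣ s ∣
subset-size s = subst (HasSize _) (length-elements s)
  (enumeration⇒size _ (elements s) (elements-sound s) (elements-unique s) elements-complete)

fibre-size : ∀ {m g} (class : Fin m → Fin g) (i : Fin g) →
             HasSize (≡.setoid (Fin m) ∣ₛ λ j → class j ≡ i) (multiplicity class i)
fibre-size class i = enumeration⇒size _ _ (Allₚ.all-filter (λ j → class j ≟ i) (allFin _))
  (Uniqueₚ.filter⁺ (λ j → class j ≟ i) (Uniqueₚ.allFin⁺ _)) (∈-filter⁺ (λ j → class j ≟ i) (∈-allFin _))

module _ {n : ℕ} {P : Fin n → Set} (P? : Decidable P) where

  ⟦_⟧ : Subset n
  ⟦_⟧ = Vec.tabulate (does ∘ P?)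

  ∈⟦⟧⁺ : ∀ {x} → P x → x ∈ ⟦_⟧
  ∈⟦⟧⁺ {x} p = lookup⇒[]= x _ (trans (lookup∘tabulate (does ∘ P?) x) (dec-true (P? x) p))

  ∈⟦⟧⁻ : ∀ {x} → x ∈ ⟦_⟧ → P x
  ∈⟦⟧⁻ {x} x∈ with P? x | trans (sym (lookup∘tabulate (does ∘ P?) x)) ([]=⇒lookup x∈)
  ... | yes p | _ = p

-- Rooted labeled graphs

record RootedLabeled (k : ℕ) : Set₁ where
  constructor ⟨_,_,_⟩
  field
    graph : Graph
    root  : V graph
    label : Labeling graph k

module _ {k : ℕ} where
  open RootedLabeled

  -- For two labelings of one rooted graph (X , x) this unfolds to Equivalent Aut[ X ⨟ x ].
  _≃_ : RootedLabeled k → RootedLabeled k → Set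
  A ≃ B = Σ (Iso (graph A) (graph B)) λ f →
            Iso.to f (root A) ≡ root B × (∀ v → label B (Iso.to f v) ≡ label A v)

  ≃-refl : ∀ {A} → A ≃ A
  ≃-refl = idIso , refl , λ _ → refl

  ≃-sym : ∀ {A B} → A ≃ B → B ≃ A
  ≃-sym {A} {B} (f , r , l) = f ⁻¹
    , trans (cong (Iso.from f) (sym r)) (Iso.strictlyInverseʳ f (root A))
    , λ v → trans (sym (l (Iso.from f v))) (cong (label B) (Iso.strictlyInverseˡ f v))

  ≃-trans : ∀ {A B C} → A ≃ B → B ≃ C → A ≃ C
  ≃-trans (f , r , l) (f′ , r′ , l′) = f ⨾ f′
    , trans (cong (Iso.to f′) r) r′
    , λ v → trans (l′ (Iso.to f v)) (l v)

  Rigid : RootedLabeled k → Set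
  Rigid A = Distinguishing Aut[ graph A ⨟ root A ] (label A)

  -- Conjugation by the isomorphism turns a symmetry of `B` into a symmetry of `A`, which is
  -- trivial.
  Rigid-resp-≃ : ∀ {A B} → A ≃ B → Rigid A → Rigid B
  Rigid-resp-≃ {A} {B} t@(f , _) rigid π r l w =
    trans (cong (Iso.to π) (sym (f.strictlyInverseˡ w)))
      (trans (sym (f.strictlyInverseˡ _))
        (trans (cong f.to (rigid (proj₁ conj) (proj₁ (proj₂ conj)) (proj₂ (proj₂ conj)) (f.from w)))
               (f.strictlyInverseˡ w)))
    where
    module f = Iso f
    conj : A ≃ A
    conj = ≃-trans {A} {B} {A} t (≃-trans {B} {B} {A} (π , r , l) (≃-sym {A} {B} t))

  Labelings : (X : Graph) → V X → Setoid 0ℓ 0ℓ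
  Labelings X x = record
    { Carrier       = Labeling X k
    ; _≈_           = Equivalent Aut[ X ⨟ x ]
    ; isEquivalence = record
      { refl  = λ {φ} → ≃-refl {⟨ X , x , φ ⟩}
      ; sym   = λ {φ} {ψ} → ≃-sym {⟨ X , x , φ ⟩} {⟨ X , x , ψ ⟩}
      ; trans = λ {φ} {ψ} {χ} → ≃-trans {⟨ X , x , φ ⟩} {⟨ X , x , ψ ⟩} {⟨ X , x , χ ⟩}
      }
    }

  RigidLabelings : (X : Graph) → V X → Setoid 0ℓ 0ℓ
  RigidLabelings X x = Labelings X x ∣ₛ λ φ → Rigid ⟨ X , x , φ ⟩

  -- Prescribing the root label makes labelings of different branches agree at their common vertex
  -- and accounts for the quotient `D / k`.
  NormalLabelings : (X : Graph) → V X → Fin k → Setoid 0ℓ 0ℓ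
  NormalLabelings X x z = Labelings X x ∣ₛ λ φ → Rigid ⟨ X , x , φ ⟩ × φ x ≡ z

-- Counting the classes of labelings of one finite rooted graph

module _ {X : Graph} (fin : Finite X) (x : V X) {k : ℕ} where
  private
    S = Labelings {k} X x
    open Setoid S using (_≈_)
    open Membership S using () renaming (_∈_ to _∈ₛ_)
    x? : Decidable (_∈ᴳ Aut[ X ⨟ x ])
    x? π = _≟V_ {X} fin (Iso.to π x) x
    ≈? = equivalent? fin {k} Aut[ X ⨟ x ] x?

  ≗⇒≈ : ∀ {φ ψ : Labeling X k} → ψ ≗ φ → φ ≈ ψ
  ≗⇒≈ e = idIso , refl , e

  labelings-complete : ∀ φ → φ ∈ₛ labelings {X} fin k
  labelings-complete φ = Anyₚ.map⁺ (Any.map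
    (λ { refl → ≗⇒≈ λ v → trans (finToFun-funToFin (φ ∘ vertex) (index v)) (cong φ (vertex-index v)) })
    (∈-allFin (funToFin (φ ∘ vertex))))
    where
    open Inverse (proj₂ fin) using () renaming
      (to to index; from to vertex; strictlyInverseʳ to vertex-index)

  ≈-decSetoid : DecSetoid 0ℓ 0ℓ
  ≈-decSetoid = record
    { isDecEquivalence = record
      { isEquivalence = Setoid.isEquivalence S ; _≟_ = ≈? } }

  -- `labelings` meets every class, `filter` does not miss a class satisfying `P` since `P` respects
  -- `≈`, and `deduplicate` leaves one representative of each.
  classes-size : {P : Labeling X k → Set} (P? : Decidable P) → P Respects _≈_ →
                 HasSize (S ∣ₛ P) (length (deduplicate ≈? (filter P? (labelings {X} fin k))))
  classes-size P? resp = enumeration⇒size S _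
    (Allₚ.deduplicate⁺ ≈? (Allₚ.all-filter P? (labelings {X} fin k)))
    (DecUniqueₚ.deduplicate-! ≈-decSetoid (filter P? (labelings {X} fin k)))
    (λ {φ} p → Membershipₚ.∈-deduplicate⁺ S ≈?
      (λ {φ} {ψ} {χ} χ≈ψ φ≈ψ → Setoid.trans S {φ} {ψ} {χ} φ≈ψ (Setoid.sym S {χ} {ψ} χ≈ψ))
      (Membershipₚ.∈-filter⁺ S P? resp (labelings-complete φ) p))

  Rigid-resp : (λ φ → Rigid ⟨ X , x , φ ⟩) Respects _≈_
  Rigid-resp {φ} {ψ} = Rigid-resp-≃ {A = ⟨ X , x , φ ⟩} {⟨ X , x , ψ ⟩}

  D-size : HasSize (RigidLabelings {k} X x) (D X fin k x)
  D-size = classes-size (distinguishing? fin Aut[ X ⨟ x ] x?) (λ {φ} {ψ} → Rigid-resp {φ} {ψ})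

  -- The root is fixed, so its label is an invariant of the class.
  root-label : ∀ {φ ψ : Labeling X k} → φ ≈ ψ → φ x ≡ ψ x
  root-label {ψ = ψ} (π , r , l) = trans (sym (l x)) (cong ψ r)

  module _ (z : Fin k) where

    normal-count : ∃ λ n → HasSize (NormalLabelings X x z) n
    normal-count = _ , classes-size
      (λ φ → distinguishing? fin Aut[ X ⨟ x ] x? φ ×-dec (φ x ≟ z))
      (λ {φ} {ψ} φ≈ψ (d , e) → Rigid-resp {φ} {ψ} φ≈ψ d , trans (sym (root-label {φ} {ψ} φ≈ψ)) e)

  -- Changing the label of the root

  relabel : Fin k → Labeling X k → Labeling X k
  relabel c φ v with _≟V_ {X} fin v x
  ... | yes _ = c
  ... | no  _ = φ v

  relabel-root : ∀ c φ → relabel c φ x ≡ c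
  relabel-root c φ with _≟V_ {X} fin x x
  ... | yes _  = refl
  ... | no x≢x = contradiction refl x≢x

  relabel-other : ∀ c φ {v} → v ≢ x → relabel c φ v ≡ φ v
  relabel-other c φ {v} v≢x with _≟V_ {X} fin v x
  ... | yes v≡x = contradiction v≡x v≢x
  ... | no _    = refl

  -- A root-fixing automorphism moves the other vertices among themselves, so only the equality of
  -- the two new root labels matters at the root.
  root-label-irrelevant : ∀ {φ ψ φ′ ψ′ : Labeling X k} (π : Aut X) → Iso.to π x ≡ x →
    (∀ {v} → v ≢ x → φ v ≡ φ′ v) → (∀ {v} → v ≢ x → ψ v ≡ ψ′ v) → φ′ x ≡ ψ′ x →
    (∀ v → ψ (Iso.to π v) ≡ φ v) → ∀ v → ψ′ (Iso.to π v) ≡ φ′ v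
  root-label-irrelevant {ψ′ = ψ′} π r off off′ at l v with _≟V_ {X} fin v x
  ... | yes refl = trans (cong ψ′ r) (sym at)
  ... | no v≢x   = trans (sym (off′ πv≢x)) (trans (l v) (off v≢x))
    where
    πv≢x : Iso.to π v ≢ x
    πv≢x e = v≢x (trans (sym (Iso.strictlyInverseʳ π v))
                   (trans (cong (Iso.from π) (trans e (sym r))) (Iso.strictlyInverseʳ π x)))

  relabel-rigid : ∀ c {φ} → Rigid ⟨ X , x , φ ⟩ → Rigid ⟨ X , x , relabel c φ ⟩
  relabel-rigid c {φ} rigid π r l =
    rigid π r (root-label-irrelevant π r (relabel-other c φ) (relabel-other c φ) refl l)

  -- The root label can be chosen independently of the rest of the labeling, whence the factor `k`.
  split-root-label : (z : Fin k) →
    Inverse (RigidLabelings X x) (≡.setoid (Fin k) ×ₛ NormalLabelings X x z)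
  split-root-label z = mkInverse (RigidLabelings X x) (≡.setoid (Fin k) ×ₛ NormalLabelings X x z)
    (λ (φ , d) → φ x , relabel z φ , relabel-rigid z d , relabel-root z φ)
    (λ (c , φ , d , _) → relabel c φ , relabel-rigid c d)
    (λ {(φ , _)} {(ψ , _)} φ≈ψ@(π , r , l) → root-label {φ} {ψ} φ≈ψ , π , r
       , root-label-irrelevant π r (sym ∘ relabel-other z φ) (sym ∘ relabel-other z ψ)
           (trans (relabel-root z φ) (sym (relabel-root z ψ))) l)
    (λ {(φ , _)} {(ψ , _)} (e , π , r , l) → π , r
       , root-label-irrelevant π r (relabel-other z φ) (relabel-other z ψ) e l)
    (λ (c , φ , _ , φx≡z) → relabel-root c φ
       , Setoid.sym S {φ} {relabel z (relabel c φ)} (≗⇒≈ (relabel-back c φ φx≡z)))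
    where
    relabel-back : ∀ c φ → φ x ≡ z → relabel z (relabel c φ) ≗ φ
    relabel-back c φ φx≡z v = case _≟V_ {X} fin v x of λ where
      (yes refl) → trans (relabel-root z (relabel c φ)) (sym φx≡z)
      (no v≢x)   → trans (relabel-other z (relabel c φ) v≢x) (relabel-other c φ v≢x)

  D≡k*normal-count : ∀ z → D X fin k x ≡ k * proj₁ (normal-count z)
  D≡k*normal-count z = size-unique {RigidLabelings X x} D-size
    (Compose.inverse (split-root-label z)
      (×-size {≡.setoid (Fin k)} {NormalLabelings X x z} (↔-refl {A = Fin k}) (proj₂ (normal-count z))))

  D/k≡normal-count : ∀ z .{{_ : NonZero k}} → D X fin k x / k ≡ proj₁ (normal-count z)
  D/k≡normal-count z = trans (cong (_/ k) (D≡k*normal-count z))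
    (trans (cong (_/ k) (*-comm k _)) (m*n/n≡m _ k))

-- Branches at a cut vertex

T-ext : ∀ {x y : Bool} → (T x → T y) → (T y → T x) → x ≡ y
T-ext {false} {false} _ _ = refl
T-ext {false} {true}  _ g with () ← g _
T-ext {true}  {false} f _ with () ← f _
T-ext {true}  {true}  _ _ = refl

module Branches {G : Graph} (finG : Finite G) {a : V G} {m : ℕ} {H : Fin m → Subgraph G}
                (dec : IsDecomposition G a H) where
  open Graph G using (adj; adj-sym; adj-irrefl; _~_)
  open IsDecomposition dec

  Hᴳ : Fin m → Graph
  Hᴳ j = asGraph (H j)

  -- Membership is stored irrelevantly and recovered from the decidability of `T`.
  member : ∀ {j} (v : V (Hᴳ j)) → value v ∈V H j
  member (v ,ᵣ [ p ]) = recompute (T? _) p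

  value-injective : ∀ {j} {u v : V (Hᴳ j)} → value u ≡ value v → u ≡ v
  value-injective {u = _ ,ᵣ _} {_ ,ᵣ _} refl = refl

  nonroot : ∀ {j} (v : V (Hᴳ j - root j)) → value (value v) ≢ a
  nonroot (v ,ᵣ [ v≢root ]) v≡a = ¬-recompute v≢root (value-injective v≡a)

  branch-unique : ∀ {j l v} → v ≢ a → v ∈V H j → v ∈V H l → j ≡ l
  branch-unique {j} {l} {v} v≢a p q with j ≟ l
  ... | yes j≡l = j≡l
  ... | no  j≢l = contradiction (V-meet j≢l v p q) v≢a

  edge-in : ∀ {u v} → u ~ v → ∃ λ j → ⟨ u , v ⟩∈E H j × u ∈V H j × v ∈V H j
  edge-in {u} {v} e = let j , e∈ , _ = E-partition u v e in
    j , e∈ , Subgraph.inE⇒inV (H j) u v e∈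
      , Subgraph.inE⇒inV (H j) v u (subst T (Subgraph.inE-sym (H j) u v) e∈)

  -- The branch carrying the edge contains `u`, and a vertex other than `a` lies in one branch only.
  ~-in-branch : ∀ {j u v} → u ≢ a → u ~ v → u ∈V H j → v ∈V H j
  ~-in-branch {v = v} u≢a e u∈ = let l , _ , u∈l , v∈l = edge-in e in
    subst (λ i → v ∈V H i) (branch-unique u≢a u∈l u∈) v∈l

  -- If an edge of `G` between vertices of `H j` lay in another branch, both its ends would be `a`,
  -- and `G` has no loops.
  induced : ∀ {j} (u v : V (Hᴳ j)) → Graph.adj (Hᴳ j) u v ≡ adj (value u) (value v)
  induced {j} u v = T-ext (Subgraph.inE⇒adj (H j) _ _) back
    where
    back : value u ~ value v → ⟨ value u , value v ⟩∈E H j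
    back e with edge-in e
    ... | l , e∈ , u∈ , v∈ with l ≟ j
    ...   | yes refl = e∈
    ...   | no l≢j with () ← subst T (adj-irrefl a) (subst T
              (cong₂ adj (V-meet l≢j _ u∈ (member u)) (V-meet l≢j _ v∈ (member v))) e)

  -- Action of automorphisms on the branches

  module _ (π : Aut G) (πa≡a : Iso.to π a ≡ a) where
    open Iso π using (to; from; adj-pres; strictlyInverseʳ)

    fixes-nonroot : ∀ {v} → v ≢ a → to v ≢ a
    fixes-nonroot v≢a e = v≢a (trans (sym (strictlyInverseʳ _))
      (trans (cong from (trans e (sym πa≡a))) (strictlyInverseʳ a)))

    -- The image of a walk avoiding `a` again avoids `a`, and a walk can change branches only at
    -- `a`.
    walk-image : ∀ {j l u v} → Star (Graph._~_ (Hᴳ j - root j)) u v →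
                 to (value (value u)) ∈V H l → to (value (value v)) ∈V H l
    walk-image ε u∈ = u∈
    walk-image {j} {u = u} (e ◅ es) u∈ = walk-image es
      (~-in-branch (fixes-nonroot (nonroot u)) (subst T (sym (adj-pres _ _)) (Subgraph.inE⇒adj (H j) _ _ e)) u∈)

    -- Since `H j - a` is connected, the single vertex `v₀` decides where the whole branch goes.
    branch-image : ∀ {j l} (v₀ : V (Hᴳ j - root j)) → to (value (value v₀)) ∈V H l →
                   (v : V (Hᴳ j)) → to (value v) ∈V H l
    branch-image {j} {l} v₀ v₀∈ v with _≟V_ {G} finG (value v) a
    ... | yes v≡a = subst (_∈V H l) (sym (trans (cong to v≡a) πa≡a)) (root∈ l)
    ... | no  v≢a = walk-image (-a-connected j v₀ (v ,ᵣ [ v≢a ∘ cong value ])) v₀∈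

  module _ {k : ℕ} where

    branch : Labeling G k → Fin m → RootedLabeled k
    branch φ j = ⟨ Hᴳ j , root j , φ ∘ value ⟩

    decompose : ∀ {φ ψ} (t : ⟨ G , a , φ ⟩ ≃ ⟨ G , a , ψ ⟩) j →
                ∃ λ l → Σ (branch φ j ≃ branch ψ l) λ h →
                  ∀ v → value (Iso.to (proj₁ h) v) ≡ Iso.to (proj₁ t) (value v)
    decompose {φ} {ψ} t@(π , r , lab) j = l , (iso , value-injective r , lab ∘ value) , λ _ → refl
      where
      open Iso π
      v₀ = -a-nonempty j
      l  = proj₁ (V-cover (to (value (value v₀))))
      w∈ = proj₂ (V-cover (to (value (value v₀))))
      -- The image of `v₀` serves as base vertex of `H l`, so that `π ⁻¹` is seen to map `H l` back
      -- into `H j`.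
      w₀ : V (Hᴳ l - root l)
      w₀ = (to (value (value v₀)) ,ᵣ [ w∈ ]) ,ᵣ [ fixes-nonroot π r (nonroot v₀) ∘ cong value ]
      fwd : ∀ v → to (value v) ∈V H l
      fwd = branch-image π r v₀ w∈
      bwd : ∀ w → from (value w) ∈V H j
      bwd = branch-image (π ⁻¹) (proj₁ (proj₂ (≃-sym {A = ⟨ G , a , φ ⟩} {⟨ G , a , ψ ⟩} t))) w₀
        (subst (_∈V H j) (sym (strictlyInverseʳ _)) (member (value v₀)))
      iso : Iso (Hᴳ j) (Hᴳ l)
      iso = record
        { bij = mk↔ₛ′ (λ v → to (value v) ,ᵣ [ fwd v ]) (λ w → from (value w) ,ᵣ [ bwd w ])
                  (λ w → value-injective (strictlyInverseˡ _)) (λ v → value-injective (strictlyInverseʳ _))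
        ; adj-pres = λ u v → trans (induced {l} (_ ,ᵣ [ fwd u ]) (_ ,ᵣ [ fwd v ]))
                               (trans (adj-pres _ _) (sym (induced u v)))
        }

    -- Gluing isomorphisms of branches

    BranchMap : (φ ψ : Labeling G k) → Set
    BranchMap φ ψ = ∀ j → ∃ λ l → branch φ j ≃ branch ψ l

    _·_ : ∀ {φ ψ j} (h : BranchMap φ ψ) → V (Hᴳ j) → V (Hᴳ (proj₁ (h j)))
    _·_ {j = j} h = Iso.to (proj₁ (proj₂ (h j)))

    module _ {φ ψ : Labeling G k} (h : BranchMap φ ψ) where

      ·-root : ∀ {j} (v : V (Hᴳ j)) → value v ≡ a → value (_·_ {φ} {ψ} h v) ≡ a
      ·-root {j} v v≡a = cong value (trans
        (cong (_·_ {φ} {ψ} h) (value-injective {v = root j} v≡a)) (proj₁ (proj₂ (proj₂ (h j)))))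

      glued : V G → V G
      glued v = let j , v∈ = V-cover v in value (_·_ {φ} {ψ} {j} h (v ,ᵣ [ v∈ ]))

      -- Independence of the branch returned by `V-cover`: only `a` lies in several branches, and
      -- every branch isomorphism sends it to `a`.
      glued-on : ∀ {j} (v : V (Hᴳ j)) → glued (value v) ≡ value (_·_ {φ} {ψ} h v)
      glued-on {j} v with V-cover (value v)
      ... | l , v∈ with l ≟ j
      ...   | yes refl = refl
      ...   | no l≢j   = trans (·-root (_ ,ᵣ [ v∈ ]) v≡a) (sym (·-root v v≡a))
        where v≡a = V-meet l≢j (value v) v∈ (member v)

      glued-~ : ∀ {u v} → u ~ v → glued u ~ glued v
      glued-~ {u} {v} e = let j , e∈ , u∈ , v∈ = edge-in e in
        subst T (sym (cong₂ adj (glued-on {j} (u ,ᵣ [ u∈ ])) (glued-on {j} (v ,ᵣ [ v∈ ]))))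
          (Subgraph.inE⇒adj (H (proj₁ (h j))) _ _
            (subst T (sym (Iso.adj-pres (proj₁ (proj₂ (h j))) (u ,ᵣ [ u∈ ]) (v ,ᵣ [ v∈ ]))) e∈))

    -- Compared as vertices of G, since the branches of the two sides are not known to coincide.
    LeftInverse : ∀ {φ ψ} → BranchMap φ ψ → BranchMap ψ φ → Set
    LeftInverse {φ} {ψ} h h′ = ∀ {j} (v : V (Hᴳ j)) → value (_·_ {ψ} {φ} h′ (_·_ {φ} {ψ} h v)) ≡ value v

    glued-inverse : ∀ {φ ψ} (h : BranchMap φ ψ) (h′ : BranchMap ψ φ) → LeftInverse {φ} {ψ} h h′ →
                    ∀ v → glued {ψ} {φ} h′ (glued {φ} {ψ} h v) ≡ v
    glued-inverse {φ} {ψ} h h′ inv v = let j , v∈ = V-cover v in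
      trans (glued-on {ψ} {φ} h′ (_·_ {φ} {ψ} {j} h (v ,ᵣ [ v∈ ]))) (inv (v ,ᵣ [ v∈ ]))

    glue : ∀ {φ ψ} (h : BranchMap φ ψ) (h′ : BranchMap ψ φ) →
           LeftInverse {φ} {ψ} h h′ → LeftInverse {ψ} {φ} h′ h →
           Σ (⟨ G , a , φ ⟩ ≃ ⟨ G , a , ψ ⟩) λ t →
             ∀ {j} (v : V (Hᴳ j)) → Iso.to (proj₁ t) (value v) ≡ value (_·_ {φ} {ψ} h v)
    glue {φ} {ψ} h h′ inv inv′ = (iso , trans (F-on (root j₀)) (·-root {φ} {ψ} h (root j₀) refl) , lab) , F-on
      where
      F = glued {φ} {ψ} h
      F-on = λ {j} → glued-on {φ} {ψ} h {j}
      j₀ = proj₁ (V-cover a)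
      F⁻¹F = glued-inverse {φ} {ψ} h h′ inv
      iso : Aut G
      iso = record
        { bij = mk↔ₛ′ F (glued {ψ} {φ} h′) (glued-inverse {ψ} {φ} h′ h inv′) F⁻¹F
        -- Edges are reflected because the inverse gluing preserves them.
        ; adj-pres = λ u v → T-ext
            (subst T (cong₂ adj (F⁻¹F u) (F⁻¹F v)) ∘ glued-~ {ψ} {φ} h′)
            (glued-~ {φ} {ψ} h)
        }
      lab : ∀ v → ψ (F v) ≡ φ v
      lab v = let j , v∈ = V-cover v in proj₂ (proj₂ (proj₂ (h j))) (v ,ᵣ [ v∈ ])

    -- The case j ≡ l is included: then t acts on H j and all other branches stay fixed.
    exchange : ∀ {φ j l} → branch φ j ≃ branch φ l → BranchMap φ φ
    exchange {φ} {j} {l} t i with i ≟ j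
    ... | yes refl = l , t
    ... | no  _ with i ≟ l
    ...   | yes refl = j , ≃-sym {A = branch φ j} {branch φ l} t
    ...   | no  _    = i , ≃-refl {A = branch φ i}

    -- `inv` settles branch `j` and `inv′` settles branch `l` when it differs from `j`; elsewhere
    -- both maps are the identity. Taking `t′` as a separate argument lets the lemma serve both
    -- orders of composition.
    exchange-inverse : ∀ {φ j l} (t : branch φ j ≃ branch φ l) (t′ : branch φ l ≃ branch φ j) →
      (∀ v → Iso.to (proj₁ t′) (Iso.to (proj₁ t) v) ≡ v) →
      (∀ w → Iso.from (proj₁ t′) (Iso.from (proj₁ t) w) ≡ w) →
      LeftInverse {φ} {φ} (exchange {φ} {j} {l} t) (exchange {φ} {l} {j} t′)
    exchange-inverse {φ} {j} {l} t t′ inv inv′ {i} v with i ≟ j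
    ... | yes refl with l ≟ l
    ...   | yes refl = cong value (inv v)
    ...   | no l≢l = contradiction refl l≢l
    exchange-inverse {φ} {j} {l} t t′ inv inv′ {i} v | no i≢j with i ≟ l
    ... | yes refl with j ≟ i
    ...   | yes j≡i = contradiction (sym j≡i) i≢j
    ...   | no _ with j ≟ j
    ...     | yes refl = cong value (inv′ v)
    ...     | no j≢j = contradiction refl j≢j
    exchange-inverse {φ} {j} {l} t t′ inv inv′ {i} v | no i≢j | no i≢l with i ≟ l
    ... | yes i≡l = contradiction i≡l i≢l
    ... | no _ with i ≟ j
    ...   | yes i≡j = contradiction i≡j i≢j
    ...   | no _ = refl

    exchange-on : ∀ {φ j l} (t : branch φ j ≃ branch φ l) v →
                  value (_·_ {φ} {φ} {j} (exchange {φ} {j} {l} t) v) ≡ value (Iso.to (proj₁ t) v)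
    exchange-on {j = j} t v with j ≟ j
    ... | yes refl = refl
    ... | no j≢j   = contradiction refl j≢j

    -- Exchanging the two branches along `t` gives a label-preserving automorphism of `G` that
    -- extends `t`, and rigidity makes it the identity.
    branch-iso-trivial : ∀ {φ j l} → Rigid ⟨ G , a , φ ⟩ → (t : branch φ j ≃ branch φ l) →
                         ∀ v → value (Iso.to (proj₁ t) v) ≡ value v
    branch-iso-trivial {φ} {j} {l} rigid t v =
      trans (sym (exchange-on {φ} {j} {l} t v))
        (trans (sym (on v)) (rigid (proj₁ s) (proj₁ (proj₂ s)) (proj₂ (proj₂ s)) (value v)))
      where
      t⁻¹ = ≃-sym {A = branch φ j} {branch φ l} t
      module t = Iso (proj₁ t)
      glued-exchange = glue {φ} {φ} (exchange {φ} {j} {l} t) (exchange {φ} {l} {j} t⁻¹)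
        (exchange-inverse {φ} {j} {l} t t⁻¹ t.strictlyInverseʳ t.strictlyInverseˡ)
        (exchange-inverse {φ} {l} {j} t⁻¹ t t.strictlyInverseˡ t.strictlyInverseʳ)
      s = proj₁ glued-exchange
      on = proj₂ glued-exchange

    -- The isomorphism fixes the nonroot vertex `v₀`, which therefore lies in both branches.
    branches-distinct : ∀ {φ j l} → Rigid ⟨ G , a , φ ⟩ → branch φ j ≃ branch φ l → j ≡ l
    branches-distinct {φ} {j} {l} rigid t = branch-unique (nonroot v₀) (member (value v₀))
      (subst (_∈V H l) (branch-iso-trivial {φ} rigid t (value v₀)) (member (Iso.to (proj₁ t) (value v₀))))
      where v₀ = -a-nonempty j

    branch-rigid : ∀ {φ} j → Rigid ⟨ G , a , φ ⟩ → Rigid (branch φ j)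
    branch-rigid {φ} j rigid π r l v = value-injective (branch-iso-trivial {φ} rigid (π , r , l) v)

    -- A symmetry of `G` restricts to isomorphisms between branches; distinctness keeps every branch
    -- in place, and its rigidity then fixes it pointwise.
    rigid-from-branches : ∀ {φ} → (∀ j → Rigid (branch φ j)) →
      (∀ {j l} → branch φ j ≃ branch φ l → j ≡ l) → Rigid ⟨ G , a , φ ⟩
    rigid-from-branches {φ} rigid distinct π r lab v with V-cover v
    ... | j , v∈ with decompose {φ} {φ} (π , r , lab) j
    ...   | l , t , on with distinct t
    ...     | refl = trans (sym (on (v ,ᵣ [ v∈ ])))
                (cong value (rigid j (proj₁ t) (proj₁ (proj₂ t)) (proj₂ (proj₂ t)) (v ,ᵣ [ v∈ ])))

    -- Each composite of `h` and `h′` is an isomorphism between branches of a single rigid labeling,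
    -- hence trivial, so the two families are mutually inverse and glue.
    branchwise-≃ : ∀ {φ ψ} → Rigid ⟨ G , a , φ ⟩ → Rigid ⟨ G , a , ψ ⟩ →
      BranchMap φ ψ → BranchMap ψ φ → ⟨ G , a , φ ⟩ ≃ ⟨ G , a , ψ ⟩
    branchwise-≃ {φ} {ψ} rigid rigid′ h h′ = proj₁ (glue {φ} {ψ} h h′
      (λ {j} → branch-iso-trivial {φ} {j} rigid
        (≃-trans {A = branch φ j} {branch ψ _} {branch φ _} (proj₂ (h j)) (proj₂ (h′ _))))
      (λ {l} → branch-iso-trivial {ψ} {l} rigid′
        (≃-trans {A = branch ψ l} {branch φ _} {branch ψ _} (proj₂ (h′ l)) (proj₂ (h _)))))

-- Labelings as choices of classes

module Counting {G : Graph} (finG : Finite G) {a : V G} {m : ℕ} {H : Fin m → Subgraph G}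
                (dec : IsDecomposition G a H) {g : ℕ} {class : Fin m → Fin g}
                {Gᵢ : Fin g → Graph} {b : ∀ i → V (Gᵢ i)}
                (classification : IsClassification dec class Gᵢ b) {k : ℕ} (z : Fin k)
                {n : Fin g → ℕ} (enum : ∀ i → HasSize (NormalLabelings (Gᵢ i) (b i) z) (n i)) where
  open IsDecomposition dec
  open IsClassification classification
  open Branches finG dec

  Normal : Set
  Normal = Setoid.Carrier (NormalLabelings G a z)

  Normalᵢ : Fin g → Set
  Normalᵢ i = Setoid.Carrier (NormalLabelings (Gᵢ i) (b i) z)

  labeled : ∀ i → Normalᵢ i → RootedLabeled k
  labeled i (φ , _) = ⟨ Gᵢ i , b i , φ ⟩

  -- Names an isomorphism class of normal labeled branches: the class of the underlying rooted graph
  -- and a number among the normal labelings of its model.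
  Code : Set
  Code = Σ (Fin g) (Fin ∘ n)

  code : ∀ i → Normalᵢ i → Code
  code i A = i , Inverse.to (enum i) A

  code-injective : ∀ {i i′} (A : Normalᵢ i) (B : Normalᵢ i′) → code i A ≡ code i′ B →
                   labeled i A ≃ labeled i′ B
  code-injective {i} A B eq with cong proj₁ eq
  ... | refl = inverse-injective {NormalLabelings (Gᵢ i) (b i) z} (enum i) {A} {B} (,-injectiveʳ eq)

  code-cong : ∀ {i i′} (A : Normalᵢ i) (B : Normalᵢ i′) → i ≡ i′ →
              labeled i A ≃ labeled i′ B → code i A ≡ code i′ B
  code-cong {i} A B refl t = cong (i ,_) (Inverse.to-cong (enum i) {A} {B} t)

  transfer : Labeling G k → ∀ j → Labeling (Gᵢ (class j)) k
  transfer φ j = φ ∘ value ∘ Iso.from (proj₁ (model j))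

  transfer-≃ : ∀ φ j → branch φ j ≃ ⟨ Gᵢ (class j) , b (class j) , transfer φ j ⟩
  transfer-≃ φ j = let f , r = model j in f , r , cong (φ ∘ value) ∘ Iso.strictlyInverseʳ f

  local : Normal → ∀ j → Normalᵢ (class j)
  local (φ , rigid , φa≡z) j = transfer φ j
    , Rigid-resp-≃ {A = branch φ j} {B} t (branch-rigid {φ = φ} j rigid)
    , trans (cong (φ ∘ value) (proj₁ (proj₂ (≃-sym {A = branch φ j} {B} t)))) φa≡z
    where
    B = ⟨ Gᵢ (class j) , b (class j) , transfer φ j ⟩
    t = transfer-≃ φ j

  branch≃local : ∀ Φ j → branch (proj₁ Φ) j ≃ labeled (class j) (local Φ j)
  branch≃local (φ , _) = transfer-≃ φ

  class-cong : ∀ {φ ψ : Labeling G k} {j l} → branch φ j ≃ branch ψ l → class j ≡ class l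
  class-cong (f , r , _) = Equivalence.from (class-kernel _ _) (f , r)

  -- Abstract because unification would otherwise unfold the proofs inside local.
  abstract
    localCode : Normal → ∀ j → Fin (n (class j))
    localCode Φ j = Inverse.to (enum (class j)) (local Φ j)

  branchCode : Normal → Fin m → Code
  branchCode Φ j = class j , localCode Φ j

  abstract
    branchCode-injective : ∀ Φ Ψ {j l} → branchCode Φ j ≡ branchCode Ψ l →
                           branch (proj₁ Φ) j ≃ branch (proj₁ Ψ) l
    branchCode-injective Φ@(φ , _) Ψ@(ψ , _) {j} {l} eq =
      ≃-trans {A = branch φ j} {labeled _ (local Φ j)} {branch ψ l} (branch≃local Φ j)
        (≃-trans {A = labeled _ (local Φ j)} {labeled _ (local Ψ l)} {branch ψ l}
          (code-injective (local Φ j) (local Ψ l) eq)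
          (≃-sym {A = branch ψ l} {labeled _ (local Ψ l)} (branch≃local Ψ l)))

    code-of-branch : ∀ Φ {j i} (A : Normalᵢ i) → class j ≡ i → branch (proj₁ Φ) j ≃ labeled i A →
                     branchCode Φ j ≡ code i A
    code-of-branch Φ@(φ , _) {j} A p t = code-cong (local Φ j) A p
      (≃-trans {A = labeled _ (local Φ j)} {branch φ j} {labeled _ A}
        (≃-sym {A = branch φ j} {labeled _ (local Φ j)} (branch≃local Φ j)) t)

    branchCode-cong : ∀ Φ Ψ {j l} → branch (proj₁ Φ) j ≃ branch (proj₁ Ψ) l →
                      branchCode Φ j ≡ branchCode Ψ l
    branchCode-cong Φ@(φ , _) Ψ@(ψ , _) {j} {l} t = code-of-branch Φ (local Ψ l) (class-cong {φ} {ψ} t)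
      (≃-trans {A = branch φ j} {branch ψ l} {labeled _ (local Ψ l)} t (branch≃local Ψ l))

  branchCode-distinct : ∀ Φ {j l} → branchCode Φ j ≡ branchCode Φ l → j ≡ l
  branchCode-distinct Φ@(φ , rigid , _) {j} {l} eq =
    branches-distinct {φ = φ} {j} {l} rigid (branchCode-injective Φ Φ eq)

  occurs? : ∀ Φ i → Decidable λ x → ∃ λ j → branchCode Φ j ≡ (i , x)
  occurs? Φ i x = any? λ j → ≡-dec _≟_ _≟_ (branchCode Φ j) (i , x)

  codes : Normal → ∀ i → Subset (n i)
  codes Φ i = ⟦ occurs? Φ i ⟧

  -- Rigidity gives different branches different codes, so the codes in class `i` correspond one to
  -- one to the branches of class `i`.
  codes-size : ∀ Φ i → ∣ codes Φ i ∣ ≡ multiplicity class i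
  codes-size Φ i = size-unique {S} (subset-size (codes Φ i)) (Compose.inverse occurrences (fibre-size class i))
    where
    S = ≡.setoid (Fin (n i)) ∣ₛ (_∈ codes Φ i)
    at : ∀ {j} → class j ≡ i → ∃ λ x → branchCode Φ j ≡ (i , x)
    at refl = _ , refl
    occurrence : ∀ {x} → x ∈ codes Φ i → ∃ λ j → branchCode Φ j ≡ (i , x)
    occurrence = ∈⟦⟧⁻ (occurs? Φ i)
    occurrences : Inverse S (≡.setoid (Fin m) ∣ₛ λ j → class j ≡ i)
    occurrences = mkInverse S (≡.setoid (Fin m) ∣ₛ λ j → class j ≡ i)
      (λ (_ , x∈) → let j , eq = occurrence x∈ in j , cong proj₁ eq)
      (λ (j , p) → proj₁ (at p) , ∈⟦⟧⁺ (occurs? Φ i) (j , proj₂ (at p)))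
      (λ { {_ , x∈} {_ , y∈} refl → branchCode-distinct Φ
             (trans (proj₂ (occurrence x∈)) (sym (proj₂ (occurrence y∈)))) })
      (λ { {_ , x∈} {_ , y∈} eq → ,-injectiveʳ (trans (sym (proj₂ (occurrence x∈)))
             (trans (cong (branchCode Φ) eq) (proj₂ (occurrence y∈)))) })
      (λ (j , p) → branchCode-distinct Φ
             (trans (proj₂ (occurrence (∈⟦⟧⁺ (occurs? Φ i) (j , proj₂ (at p))))) (sym (proj₂ (at p)))))

  codes-⊆ : ∀ Φ Ψ → ⟨ G , a , proj₁ Φ ⟩ ≃ ⟨ G , a , proj₁ Ψ ⟩ → ∀ i → codes Φ i ⊆ codes Ψ i
  codes-⊆ Φ@(φ , _) Ψ@(ψ , _) t i x∈ =
    let j , eq = ∈⟦⟧⁻ (occurs? Φ i) x∈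
        l , h , _ = decompose {φ = φ} {ψ} t j
    in ∈⟦⟧⁺ (occurs? Ψ i) (l , trans (sym (branchCode-cong Φ Ψ h)) eq)

  codes-branchMap : ∀ Φ Ψ → (∀ i → codes Φ i ≡ codes Ψ i) → BranchMap (proj₁ Φ) (proj₁ Ψ)
  codes-branchMap Φ Ψ eq j =
    let l , e = ∈⟦⟧⁻ (occurs? Ψ (class j))
                  (subst (_ ∈_) (eq (class j)) (∈⟦⟧⁺ (occurs? Φ (class j)) (j , refl)))
    in l , branchCode-injective Φ Ψ (sym e)

  -- Realizing a choice of codes by a labeling

  Choices : Setoid 0ℓ 0ℓ
  Choices = Πₛ λ i → SubsetsOfSize (n i) (multiplicity class i)

  module Realize (s : Setoid.Carrier Choices) where

    -- Both sides have `multiplicity class i` elements. The particular bijection is immaterial,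
    -- since labelings with the same codes are equivalent.
    assign : ∀ i → Inverse (≡.setoid (Fin m) ∣ₛ λ j → class j ≡ i)
                           (≡.setoid (Fin (n i)) ∣ₛ (_∈ proj₁ (s i)))
    assign i = Compose.inverse (fibre-size class i)
      (Symmetry.inverse (subst (HasSize _) (proj₂ (s i)) (subset-size (proj₁ (s i)))))

    -- The index `i` is kept apart from `class j` because the inverse of `assign i` returns a branch
    -- together with a proof of `class j ≡ i`.
    pick : ∀ {i j} → class j ≡ i → Code
    pick {i} {j} p = i , proj₁ (Inverse.to (assign i) (j , p))

    pick-injective : ∀ {i i′ j l} (p : class j ≡ i) (q : class l ≡ i′) → pick p ≡ pick q → j ≡ l
    pick-injective {i} p q eq with cong proj₁ eq
    ... | refl = inverse-injective {≡.setoid (Fin m) ∣ₛ λ j → class j ≡ i}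
                   {≡.setoid (Fin (n i)) ∣ₛ (_∈ proj₁ (s i))}
                   (assign i) {_ , p} {_ , q} (,-injectiveʳ eq)

    chosen : ∀ j → Normalᵢ (class j)
    chosen j = Inverse.from (enum (class j)) (proj₂ (pick {j = j} refl))

    code-chosen : ∀ j → code (class j) (chosen j) ≡ pick {j = j} refl
    code-chosen j = cong (class j ,_) (Inverse.strictlyInverseˡ (enum (class j)) _)

    onBranch : ∀ j → Labeling (Hᴳ j) k
    onBranch j = proj₁ (chosen j) ∘ Iso.to (proj₁ (model j))

    onBranch-root : ∀ j v → value v ≡ a → onBranch j v ≡ z
    onBranch-root j v v≡a = trans
      (cong (proj₁ (chosen j)) (trans
        (cong (Iso.to (proj₁ (model j))) (value-injective {v = root j} v≡a)) (proj₂ (model j))))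
      (proj₂ (proj₂ (chosen j)))

    φ : Labeling G k
    φ v = let j , v∈ = V-cover v in onBranch j (asVertex (H j) v v∈)

    -- All the chosen labelings give the root the label `z`, so they agree where branches meet.
    φ-on : ∀ {j} v → φ (value v) ≡ onBranch j v
    φ-on {j} v with V-cover (value v)
    ... | l , v∈ with l ≟ j
    ...   | yes refl = refl
    ...   | no l≢j   = trans (onBranch-root l (asVertex (H l) _ v∈) v≡a) (sym (onBranch-root j v v≡a))
      where v≡a = V-meet l≢j (value v) v∈ (member v)

    branch≃chosen : ∀ j → branch φ j ≃ labeled (class j) (chosen j)
    branch≃chosen j = let f , r = model j in f , r , sym ∘ φ-on

    -- Isomorphic branches would have received the same code, but the assignment of codes is
    -- injective.
    distinct : ∀ {j l} → branch φ j ≃ branch φ l → j ≡ l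
    distinct {j} {l} t = pick-injective refl refl
      (trans (sym (code-chosen j)) (trans (code-cong (chosen j) (chosen l) (class-cong {φ} {φ} t)
        (≃-trans {A = labeled _ (chosen j)} {branch φ j} {labeled _ (chosen l)}
          (≃-sym {A = branch φ j} {labeled _ (chosen j)} (branch≃chosen j))
          (≃-trans {A = branch φ j} {branch φ l} {labeled _ (chosen l)} t (branch≃chosen l))))
        (code-chosen l)))

    Φ : Normal
    Φ = φ
      , rigid-from-branches {φ = φ}
          (λ j → Rigid-resp-≃ {A = labeled _ (chosen j)} {branch φ j}
                   (≃-sym {A = branch φ j} {labeled _ (chosen j)} (branch≃chosen j)) (proj₁ (proj₂ (chosen j))))
          distinct
      , onBranch-root _ _ refl

    branchCode-Φ : ∀ {i j} (p : class j ≡ i) → branchCode Φ j ≡ pick p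
    branchCode-Φ {j = j} refl = trans (code-of-branch Φ (chosen j) refl (branch≃chosen j)) (code-chosen j)

    codes-Φ : ∀ i → codes Φ i ≡ proj₁ (s i)
    codes-Φ i = ⊆-antisym
      (λ x∈ → let j , eq = ∈⟦⟧⁻ (occurs? Φ i) x∈ in
        subst (λ (i , x) → x ∈ proj₁ (s i)) (trans (sym (branchCode-Φ refl)) eq)
          (proj₂ (Inverse.to (assign (class j)) (j , refl))))
      (λ {x} x∈ → let j , p = Inverse.from (assign i) (x , x∈) in
        ∈⟦⟧⁺ (occurs? Φ i) (j , trans (branchCode-Φ p)
          (cong (i ,_) (Inverse.strictlyInverseˡ (assign i) (x , x∈)))))

  -- Well defined because an equivalence carries branches to isomorphic branches, injective because
  -- branchwise isomorphisms glue, and surjective by `Realize`.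
  labelings≅choices : Inverse (NormalLabelings G a z) Choices
  labelings≅choices = mkInverse (NormalLabelings G a z) Choices
    (λ Φ i → codes Φ i , codes-size Φ i)
    Realize.Φ
    (λ {Φ} {Ψ} t i → ⊆-antisym (codes-⊆ Φ Ψ t i)
       (codes-⊆ Ψ Φ (≃-sym {A = ⟨ G , a , proj₁ Φ ⟩} {⟨ G , a , proj₁ Ψ ⟩} t) i))
    (λ {Φ} {Ψ} eq → branchwise-≃ {φ = proj₁ Φ} {proj₁ Ψ} (proj₁ (proj₂ Φ)) (proj₁ (proj₂ Ψ))
       (codes-branchMap Φ Ψ eq) (codes-branchMap Ψ Φ (sym ∘ eq)))
    Realize.codes-Φ

  normal-size : HasSize (NormalLabelings G a z) (product (tabulate λ i → n i C multiplicity class i))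
  normal-size = Compose.inverse labelings≅choices (Π-size λ i → subsets-size (n i) (multiplicity class i))

theorem6 : (G : Graph) (finG : Finite G) (a : V G)
    (m : ℕ) → m ≥ 1 →
    (H : Fin m → Subgraph G) (dec : IsDecomposition G a H)
    (g : ℕ) (class : Fin m → Fin g)
    (Gᵢ : Fin g → Graph) (finGᵢ : ∀ i → Finite (Gᵢ i)) (b : ∀ i → V (Gᵢ i)) →
    IsClassification dec class Gᵢ b →
    (k : ℕ) .{{_ : NonZero k}} →
    D G finG k a ≡
    k * product (tabulate λ i → (D (Gᵢ i) (finGᵢ i) k (b i) / k) C multiplicity class i)
theorem6 G finG a m _ H dec g class Gᵢ finGᵢ b classification k@(suc _) = trans
  -- As `k` is positive, `zero` is available as the normal root label, for `G` and for all the
  -- models.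
  (D≡k*normal-count finG a zero)
  (cong (k *_) (trans
    -- The normal labelings of `G` are counted twice: by direct enumeration and through the choices
    -- of codes.
    (size-unique {NormalLabelings G a zero} (proj₂ (normal-count finG a zero))
      (Counting.normal-size finG dec classification zero λ i → proj₂ (normal-count (finGᵢ i) (b i) zero)))
    (cong product (tabulate-cong λ i →
      cong (_C multiplicity class i) (sym (D/k≡normal-count (finGᵢ i) (b i) zero))))))
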